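{- Let $p$ be a prime, let $\chi$ be a non-principal Dirichlet character modulo $p$, and let $f$ be the completely multiplicative function with $f(p)=1$ and $f(q)=\chi(q)$ for every prime $q\neq p$. For $0\le l\le p-1$ let $N(n,l)$ be the number of digits equal to $l$ in the base $p$ expansion of $n$. Then for every positive integer $n$, $$\sum_{j=1}^n f(j)=\sum_{l=0}^{p-1}N(n,l)\left(\sum_{m\le l}\chi(m)\right).$$
   Context: The inner sum $\sum_{m\le l}\chi(m)$ is over positive integers $m\le l$ (empty for $l=0$). By complete multiplicativity, $f(p^lm)=\chi(m)$ for $l\ge0$ and $p\nmid m$. -}

module Defs where

open import Level using (0ℓ)
open import Algebra.Bundles using (RawRing)
import Algebra.Definitions.RawMonoid as RawMonoidDefs
open import Data.Digit using (Digit; toDigits)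
open import Data.Fin.Base using (Fin; toℕ)
import Data.Fin.Properties as Fin
open import Data.Integer.Base as ℤ using (ℤ; +_)
open import Data.Integer.Coprimality using (Coprime)
open import Data.List.Base using (length; filter)
open import Data.Nat.Base as ℕ using (ℕ; suc; NonTrivial; nonTrivial⇒n>1)
import Data.Nat.Properties as ℕ
open import Data.Product.Base using (_×_; _,_; ∃; proj₁; proj₂)
open import Data.Rational.Base
  using (ℚ; 0ℚ; 1ℚ; ½; ∣_∣; _+_; _*_; _-_; -_; 1/_; _<_; _≤_; Positive; positive; nonNegative)
open import Data.Rational.Properties
open import Data.Rational.Solver using (module +-*-Solver)
open import Function.Bundles using (_⇔_)
open import Relation.Nullary using (¬_)
open import Relation.Nullary.Decidable using (fromWitness)
open import Relation.Binary.PropositionalEquality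
  using (_≡_; refl; cong; cong₂; subst; module ≡-Reasoning)

Cauchy : (ℕ → ℚ) → Set
Cauchy x = ∀ ε → 0ℚ < ε →
  ∃ λ N → ∀ m n → N ℕ.≤ m → N ℕ.≤ n → ∣ x m - x n ∣ < ε

-- Real numbers are Cauchy sequences of rationals, compared by _≈ℝ_ below.
record ℝ : Set where
  constructor mkℝ
  field
    seq    : ℕ → ℚ
    cauchy : Cauchy seq

open ℝ

infix 4 _≈ℝ_

record _≈ℝ_ (x y : ℝ) : Set where
  constructor mk≈ℝ
  field
    difference→0 : ∀ ε → 0ℚ < ε →
      ∃ λ N → ∀ n → N ℕ.≤ n → ∣ seq x n - seq y n ∣ < ε

open +-*-Solver using (solve; _:+_; _:*_; _:-_; _:=_)

abstract

  0<* : ∀ {p q} → 0ℚ < p → 0ℚ < q → 0ℚ < p * q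
  0<* {p} {q} 0<p 0<q =
    positive⁻¹ (p * q) {{pos*pos⇒pos p {{positive 0<p}} q {{positive 0<q}}}}

  const-cauchy : ∀ c → Cauchy (λ _ → c)
  const-cauchy c ε 0<ε = 0 , λ _ _ _ _ →
    ≤-<-trans (≤-reflexive (cong ∣_∣ (+-inverseʳ c))) 0<ε

  +-cauchy : ∀ x y → Cauchy x → Cauchy y → Cauchy (λ n → x n + y n)
  +-cauchy x y cx cy ε 0<ε
    with cx (ε * ½) (0<* 0<ε (positive⁻¹ ½)) | cy (ε * ½) (0<* 0<ε (positive⁻¹ ½))
  ... | N , hx | N′ , hy = N ℕ.⊔ N′ , λ m n N≤m N≤n → begin-strict
    ∣ (x m + y m) - (x n + y n) ∣     ≡⟨ cong ∣_∣ (regroup (x m) (y m) (x n) (y n)) ⟩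
    ∣ (x m - x n) + (y m - y n) ∣     ≤⟨ ∣p+q∣≤∣p∣+∣q∣ (x m - x n) (y m - y n) ⟩
    ∣ x m - x n ∣ + ∣ y m - y n ∣     <⟨ +-mono-<
      (hx m n (ℕ.m⊔n≤o⇒m≤o N N′ N≤m) (ℕ.m⊔n≤o⇒m≤o N N′ N≤n))
      (hy m n (ℕ.m⊔n≤o⇒n≤o N N′ N≤m) (ℕ.m⊔n≤o⇒n≤o N N′ N≤n)) ⟩
    ε * ½ + ε * ½                     ≡⟨ *-distribˡ-+ ε ½ ½ ⟨
    ε * 1ℚ                            ≡⟨ *-identityʳ ε ⟩
    ε                                 ∎
    where
    open ≤-Reasoning
    regroup : ∀ a b c d → (a + b) - (c + d) ≡ (a - c) + (b - d)
    regroup = solve 4 (λ a b c d → (a :+ b) :- (c :+ d) := (a :- c) :+ (b :- d)) refl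

  neg-cauchy : ∀ x → Cauchy x → Cauchy (λ n → - x n)
  neg-cauchy x cx ε 0<ε with cx ε 0<ε
  ... | N , h = N , λ m n N≤m N≤n → begin-strict
    ∣ - x m - - x n ∣     ≡⟨ cong ∣_∣ (neg-distrib-+ (x m) (- x n)) ⟨
    ∣ - (x m - x n) ∣     ≡⟨ ∣-p∣≡∣p∣ (x m - x n) ⟩
    ∣ x m - x n ∣         <⟨ h m n N≤m N≤n ⟩
    ε                     ∎
    where open ≤-Reasoning

  bounded : ∀ x → Cauchy x →
    ∃ λ B → 0ℚ < B × ∃ λ N → ∀ n → N ℕ.≤ n → ∣ x n ∣ ≤ B
  bounded x cx with cx 1ℚ (positive⁻¹ 1ℚ)
  ... | N , h = 1ℚ + ∣ x N ∣ , +-mono-<-≤ (positive⁻¹ 1ℚ) (0≤∣p∣ (x N)) , N , λ n N≤n → begin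
    ∣ x n ∣                     ≡⟨ cong ∣_∣ (regroup (x n) (x N)) ⟩
    ∣ (x n - x N) + x N ∣       ≤⟨ ∣p+q∣≤∣p∣+∣q∣ (x n - x N) (x N) ⟩
    ∣ x n - x N ∣ + ∣ x N ∣     ≤⟨ +-monoˡ-≤ ∣ x N ∣ (<⇒≤ (h n N N≤n ℕ.≤-refl)) ⟩
    1ℚ + ∣ x N ∣                ∎
    where
    open ≤-Reasoning
    regroup : ∀ a b → a ≡ (a - b) + b
    regroup = solve 2 (λ a b → a := (a :- b) :+ b) refl

  quotient : ∀ {D ε} → 0ℚ < D → 0ℚ < ε → ∃ λ δ → 0ℚ < δ × D * δ ≡ ε
  quotient {D} {ε} 0<D 0<ε =
    1/D * ε , 0<* (positive⁻¹ 1/D {{1/pos⇒pos D {{D>0}}}}) 0<ε , (begin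
      D * (1/D * ε)     ≡⟨ *-assoc D 1/D ε ⟨
      D * 1/D * ε       ≡⟨ cong (_* ε) (*-inverseʳ D {{pos⇒nonZero D {{D>0}}}}) ⟩
      1ℚ * ε            ≡⟨ *-identityˡ ε ⟩
      ε                 ∎)
    where
    open ≡-Reasoning
    D>0 : Positive D
    D>0 = positive 0<D
    1/D : ℚ
    1/D = (1/ D) {{pos⇒nonZero D {{D>0}}}}

  *-regroup : ∀ a b c d → a * b - c * d ≡ a * (b - d) + d * (a - c)
  *-regroup = solve 4 (λ a b c d → a :* b :- c :* d := a :* (b :- d) :+ d :* (a :- c)) refl

  *-estimate : ∀ {B C δ} a b c d → 0ℚ < B → 0ℚ < C →
    ∣ a ∣ ≤ B → ∣ d ∣ ≤ C → ∣ a - c ∣ < δ → ∣ b - d ∣ < δ →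
    ∣ a * b - c * d ∣ < (B + C) * δ
  *-estimate {B} {C} {δ} a b c d 0<B 0<C a≤B d≤C ac<δ bd<δ = begin-strict
    ∣ a * b - c * d ∣                           ≡⟨ cong ∣_∣ (*-regroup a b c d) ⟩
    ∣ a * (b - d) + d * (a - c) ∣               ≤⟨ ∣p+q∣≤∣p∣+∣q∣ (a * (b - d)) (d * (a - c)) ⟩
    ∣ a * (b - d) ∣ + ∣ d * (a - c) ∣           ≡⟨ cong₂ _+_ (∣p*q∣≡∣p∣*∣q∣ a (b - d)) (∣p*q∣≡∣p∣*∣q∣ d (a - c)) ⟩
    ∣ a ∣ * ∣ b - d ∣ + ∣ d ∣ * ∣ a - c ∣       ≤⟨ +-mono-≤
      (*-monoʳ-≤-nonNeg ∣ b - d ∣ {{nonNegative (0≤∣p∣ (b - d))}} a≤B)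
      (*-monoʳ-≤-nonNeg ∣ a - c ∣ {{nonNegative (0≤∣p∣ (a - c))}} d≤C) ⟩
    B * ∣ b - d ∣ + C * ∣ a - c ∣               <⟨ +-mono-<
      (*-monoʳ-<-pos B {{positive 0<B}} bd<δ)
      (*-monoʳ-<-pos C {{positive 0<C}} ac<δ) ⟩
    B * δ + C * δ                               ≡⟨ *-distribʳ-+ δ B C ⟨
    (B + C) * δ                                 ∎
    where open ≤-Reasoning

  *-cauchy : ∀ x y → Cauchy x → Cauchy y → Cauchy (λ n → x n * y n)
  *-cauchy x y cx cy ε 0<ε =
    let B , 0<B , M , x≤B   = bounded x cx
        C , 0<C , M′ , y≤C  = bounded y cy
        δ , 0<δ , D*δ≡ε     = quotient (+-mono-< 0<B 0<C) 0<ε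
        L , x<δ             = cx δ 0<δ
        L′ , y<δ            = cy δ 0<δ
        N = (M ℕ.⊔ M′) ℕ.⊔ (L ℕ.⊔ L′)
        ≥M⊔M′ = λ {k} (h : N ℕ.≤ k) → ℕ.m⊔n≤o⇒m≤o (M ℕ.⊔ M′) (L ℕ.⊔ L′) h
        ≥L⊔L′ = λ {k} (h : N ℕ.≤ k) → ℕ.m⊔n≤o⇒n≤o (M ℕ.⊔ M′) (L ℕ.⊔ L′) h
    in N , λ m n N≤m N≤n → subst (_ <_) D*δ≡ε
         (*-estimate (x m) (y m) (x n) (y n) 0<B 0<C
           (x≤B m (ℕ.m⊔n≤o⇒m≤o M M′ (≥M⊔M′ N≤m)))
           (y≤C n (ℕ.m⊔n≤o⇒n≤o M M′ (≥M⊔M′ N≤n)))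
           (x<δ m n (ℕ.m⊔n≤o⇒m≤o L L′ (≥L⊔L′ N≤m)) (ℕ.m⊔n≤o⇒m≤o L L′ (≥L⊔L′ N≤n)))
           (y<δ m n (ℕ.m⊔n≤o⇒n≤o L L′ (≥L⊔L′ N≤m)) (ℕ.m⊔n≤o⇒n≤o L L′ (≥L⊔L′ N≤n))))

infixl 6 _+ℝ_
infixl 7 _*ℝ_
infix  8 -ℝ_

_+ℝ_ _*ℝ_ : ℝ → ℝ → ℝ
x +ℝ y = mkℝ (λ n → seq x n + seq y n) (+-cauchy (seq x) (seq y) (cauchy x) (cauchy y))
x *ℝ y = mkℝ (λ n → seq x n * seq y n) (*-cauchy (seq x) (seq y) (cauchy x) (cauchy y))

-ℝ_ : ℝ → ℝ
-ℝ x = mkℝ (λ n → - seq x n) (neg-cauchy (seq x) (cauchy x))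

fromℚ : ℚ → ℝ
fromℚ q = mkℝ (λ _ → q) (const-cauchy q)

record ℂ : Set where
  constructor _+i_
  field
    re im : ℝ

open ℂ

infix 4 _≈_

record _≈_ (z w : ℂ) : Set where
  constructor mk≈
  field
    re≈ : re z ≈ℝ re w
    im≈ : im z ≈ℝ im w

ℂ-rawRing : RawRing 0ℓ 0ℓ
ℂ-rawRing = record
  { Carrier = ℂ
  ; _≈_     = _≈_
  ; _+_     = λ z w → (re z +ℝ re w) +i (im z +ℝ im w)
  ; _*_     = λ z w → (re z *ℝ re w +ℝ (-ℝ (im z *ℝ im w)))
                   +i (re z *ℝ im w +ℝ im z *ℝ re w)
  ; -_      = λ z → (-ℝ re z) +i (-ℝ im z)
  ; 0#      = fromℚ 0ℚ +i fromℚ 0ℚ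
  ; 1#      = fromℚ 1ℚ +i fromℚ 0ℚ
  }

open RawRing ℂ-rawRing public
  using () renaming (_+_ to _+ℂ_; _*_ to _*ℂ_; 0# to 0ℂ; 1# to 1ℂ)

-- `sum v` is the sum of a finite family v : Fin n → ℂ, and `k · z` is the
-- natural multiple z + … + z (k summands).
open RawMonoidDefs (RawRing.+-rawMonoid ℂ-rawRing) public
  using (sum) renaming (_×_ to _·_)

-- ∑₁ n g = g 1 + … + g n; it is 0 for n = 0.
∑₁ : ℕ → (ℕ → ℂ) → ℂ
∑₁ n g = sum {n} (λ i → g (suc (toℕ i)))

record IsDirichletCharacter (k : ℕ) (χ : ℤ → ℂ) : Set where
  field
    periodic       : ∀ a → χ (a ℤ.+ + k) ≈ χ a
    one            : χ (+ 1) ≈ 1ℂ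
    multiplicative : ∀ a b → χ (a ℤ.* b) ≈ χ a *ℂ χ b
    vanishing      : ∀ a → χ a ≈ 0ℂ ⇔ (¬ Coprime a (+ k))

IsPrincipal : ℕ → (ℤ → ℂ) → Set
IsPrincipal k χ = ∀ a → Coprime a (+ k) → χ a ≈ 1ℂ

-- Arithmetic functions are defined on the positive integers, so the value at
-- 0 is left unconstrained.
record IsCompletelyMultiplicative (f : ℕ → ℂ) : Set where
  field
    one            : f 1 ≈ 1ℂ
    multiplicative : ∀ m n → .{{ℕ.NonZero m}} → .{{ℕ.NonZero n}} →
                     f (m ℕ.* n) ≈ f m *ℂ f n

digitCount : (b : ℕ) → .{{NonTrivial b}} → ℕ → Digit b → ℕ
digitCount b n l =
  length (filter (l Fin.≟_) (proj₁ (toDigits b {fromWitness (nonTrivial⇒n>1 b)} n)))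

module Submission where

-- Let X(l) = χ(1) + … + χ(l) and F(n) = f(1) + … + f(n).  In F(r + q p), with
-- 0 ≤ r < p, the terms f(j) with p ∣ j add up to F(q), because f(p i) = f(i),
-- and the others to X(r), because f(j) = χ(j) there and every full period of
-- χ sums to 0.  Iterating F(r + q p) = F(q) + X(r) over the base p digits of n
-- gives the formula.
--
-- For the vanishing of the period sum S, reindexing by i ↦ a i mod p gives
-- S (χ(a) - 1) = 0 for all a coprime to p.  Constructively ¬ IsPrincipal does
-- not produce an a with χ(a) ≠ 1; instead, S ≉ 0 would force χ(a) ≈ 1 for all
-- such a, and being equal to 0 is a ¬¬-stable property of Cauchy reals.

open import Defs
open import Data.Fin.Base using (Fin; toℕ)
open import Data.Integer.Base using (ℤ; +_)
open import Data.Nat.Base using (ℕ; NonZero)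
open import Data.Nat.Primality using (Prime; prime⇒nonTrivial)
open import Relation.Nullary using (¬_)
open import Relation.Binary.PropositionalEquality using (_≢_)

open import Algebra.Bundles using (CommutativeRing; RawRing)
import Algebra.Properties.CommutativeMonoid.Sum as Sum
import Algebra.Properties.Group as GroupProperties
import Algebra.Properties.Ring as RingProperties
import Algebra.Properties.Semiring.Sum as SemiringSumProperties
open import Data.Bool.Base using (true; false; if_then_else_)
open import Data.Digit using (Digit; toDigits; fromDigits)
open import Data.Fin.Base using (zero; suc; fromℕ<)
open import Data.Fin.Permutation using (Permutation; permutation)
import Data.Fin.Properties as Fin
open import Data.Fin.Properties using (toℕ-inject₁; toℕ-fromℕ; toℕ-fromℕ<; toℕ-injective; toℕ<n)
open import Data.Integer.Base using (-[1+_]; _%ℕ_; _/ℕ_) renaming (_+_ to _+ℤ_; _*_ to _*ℤ_)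
import Data.Integer.Coprimality as ℤ
import Data.Integer.Divisibility.Signed as ℤ
open import Data.Integer.DivMod using (a≡a%ℕn+[a/ℕn]*n)
import Data.Integer.Properties as ℤ
open import Data.List.Base using (List; []; _∷_; length; filter)
open import Data.List.Relation.Unary.All using (All; []; _∷_)
open import Data.Nat.Base as ℕ using (zero; suc; _⊔_; _%_; nonTrivial⇒n>1)
open import Data.Nat.Coprimality using (Coprime; coprime-Bézout; 0-coprimeTo-m⇒m≡1)
open import Data.Nat.Divisibility using (_∣_; m∣m*n; n∣m*n; ∣n⇒∣m*n; ∣m+n∣m⇒∣n; >⇒∤)
open import Data.Nat.DivMod using (m%n<n; [m+kn]%n≡m%n; %-distribˡ-*; m%n%n≡m%n; m<n⇒m%n≡m)
open import Data.Nat.GCD using (module Bézout)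
open import Data.Nat.ListAction using (product)
open import Data.Nat.Primality using (¬prime[0]; ¬prime[1]; prime⇒nonZero; productOfPrimes≢0)
open import Data.Nat.Primality.Factorisation using (factorise; module PrimeFactorisation)
import Data.Nat.Properties as ℕ
open import Data.Nat.Tactic.RingSolver using (solve-∀)
open import Data.Product.Base using (_×_; _,_; ∃; proj₁; proj₂)
open import Data.Rational.Base
  using (ℚ; 0ℚ; 1ℚ; ½; ∣_∣; _+_; _*_; _-_; -_; _<_; _≤_; nonNegative)
open import Data.Rational.Properties
open import Data.Rational.Solver using (module +-*-Solver)
open import Data.Sum.Base using (_⊎_; inj₁; inj₂)
open import Function.Base using (_∘_)
open import Function.Bundles using (Equivalence)
open import Level using (0ℓ)
import Relation.Binary.Reasoning.Setoid as SetoidReasoning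
open import Relation.Nullary using (contradiction; yes; no; does)
open import Relation.Nullary.Decidable using (fromWitness)
open import Relation.Binary.PropositionalEquality
  using (_≡_; refl; sym; trans; cong; cong₂; subst; subst₂; module ≡-Reasoning)

open +-*-Solver using (solve; con; _:+_; _:*_; _:-_; :-_; _:=_)
open PrimeFactorisation
open ℝ
open _≈ℝ_
open ℂ
open _≈_

-- Equality of Cauchy reals as a congruence.

pointwise : ∀ {x y} → (∀ n → seq x n ≡ seq y n) → x ≈ℝ y
pointwise {x} {y} x≡y .difference→0 ε 0<ε = 0 , λ n _ →
  ≤-<-trans (≤-reflexive (cong ∣_∣ (trans (cong (_- seq y n) (x≡y n)) (+-inverseʳ (seq y n))))) 0<ε

≈ℝ-sym : ∀ {x y} → x ≈ℝ y → y ≈ℝ x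
≈ℝ-sym {x} {y} x≈y .difference→0 ε 0<ε with x≈y .difference→0 ε 0<ε
... | N , h = N , λ n N≤n → subst (_< ε) (d-sym (seq x n) (seq y n)) (h n N≤n)
  where
  d-sym : ∀ a b → ∣ a - b ∣ ≡ ∣ b - a ∣
  d-sym a b = trans (sym (∣-p∣≡∣p∣ (a - b)))
    (cong ∣_∣ (solve 2 (λ a b → :- (a :- b) := b :- a) refl a b))

half : ∀ {ε} → 0ℚ < ε → 0ℚ < ε * ½
half 0<ε = 0<* 0<ε (positive⁻¹ ½)

half+half : ∀ ε → ε * ½ + ε * ½ ≡ ε
half+half ε = trans (sym (*-distribˡ-+ ε ½ ½)) (*-identityʳ ε)

-- The one ε/2 argument behind transitivity and the congruence of addition and negation: each of
-- them only has to write `w - z` termwise as a sum of two differences that tend to 0.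
sum-close : ∀ {x y u v w z} → (∀ n → (seq x n - seq y n) + (seq u n - seq v n) ≡ seq w n - seq z n) →
            x ≈ℝ y → u ≈ℝ v → w ≈ℝ z
sum-close {x} {y} {u} {v} {w} {z} eq x≈y u≈v .difference→0 ε 0<ε
  with x≈y .difference→0 (ε * ½) (half 0<ε) | u≈v .difference→0 (ε * ½) (half 0<ε)
... | N , h | N′ , h′ = N ⊔ N′ , λ n le → begin-strict
  ∣ seq w n - seq z n ∣                             ≡⟨ cong ∣_∣ (eq n) ⟨
  ∣ (seq x n - seq y n) + (seq u n - seq v n) ∣     ≤⟨ ∣p+q∣≤∣p∣+∣q∣ (seq x n - seq y n) (seq u n - seq v n) ⟩
  ∣ seq x n - seq y n ∣ + ∣ seq u n - seq v n ∣     <⟨ +-mono-< (h n (ℕ.m⊔n≤o⇒m≤o N N′ le))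
                                                                 (h′ n (ℕ.m⊔n≤o⇒n≤o N N′ le)) ⟩
  ε * ½ + ε * ½                                     ≡⟨ half+half ε ⟩
  ε                                                 ∎
  where open ≤-Reasoning

≈ℝ-trans : ∀ {x y z} → x ≈ℝ y → y ≈ℝ z → x ≈ℝ z
≈ℝ-trans {x} {y} {z} = sum-close λ n →
  solve 3 (λ a b c → (a :- b) :+ (b :- c) := a :- c) refl (seq x n) (seq y n) (seq z n)

+ℝ-cong : ∀ {x y u v} → x ≈ℝ y → u ≈ℝ v → x +ℝ u ≈ℝ y +ℝ v
+ℝ-cong {x} {y} {u} {v} = sum-close λ n →
  solve 4 (λ a b c d → (a :- b) :+ (c :- d) := (a :+ c) :- (b :+ d)) refl (seq x n) (seq y n) (seq u n) (seq v n)

-ℝ-cong : ∀ {x y} → x ≈ℝ y → -ℝ x ≈ℝ -ℝ y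
-ℝ-cong {x} {y} x≈y = sum-close
  (λ n → solve 2 (λ a b → (b :- a) :+ (a :- a) := (:- a) :- (:- b)) refl (seq x n) (seq y n))
  (≈ℝ-sym x≈y) (pointwise {x} {x} λ _ → refl)

-- From xu - yv = x(u - v) + v(x - y): it is enough to bound `x` and `v`, say by B and C, and to
-- make both differences smaller than δ = ε / (B + C).
*ℝ-cong : ∀ {x y u v} → x ≈ℝ y → u ≈ℝ v → x *ℝ u ≈ℝ y *ℝ v
*ℝ-cong {x} {y} {u} {v} x≈y u≈v .difference→0 ε 0<ε =
  let B , 0<B , M , x≤B   = bounded (seq x) (cauchy x)
      C , 0<C , M′ , v≤C  = bounded (seq v) (cauchy v)
      δ , 0<δ , D*δ≡ε     = quotient (+-mono-< 0<B 0<C) 0<ε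
      L , xy<δ            = x≈y .difference→0 δ 0<δ
      L′ , uv<δ           = u≈v .difference→0 δ 0<δ
  in (M ⊔ M′) ⊔ (L ⊔ L′) , λ n N≤n →
    let M⊔M′≤n = ℕ.m⊔n≤o⇒m≤o (M ⊔ M′) (L ⊔ L′) N≤n
        L⊔L′≤n = ℕ.m⊔n≤o⇒n≤o (M ⊔ M′) (L ⊔ L′) N≤n
    in subst (_ <_) D*δ≡ε
         (*-estimate (seq x n) (seq u n) (seq y n) (seq v n) 0<B 0<C
           (x≤B n (ℕ.m⊔n≤o⇒m≤o M M′ M⊔M′≤n)) (v≤C n (ℕ.m⊔n≤o⇒n≤o M M′ M⊔M′≤n))
           (xy<δ n (ℕ.m⊔n≤o⇒m≤o L L′ L⊔L′≤n)) (uv<δ n (ℕ.m⊔n≤o⇒n≤o L L′ L⊔L′≤n)))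

-- The commutative ring of complex numbers.

pointwiseℂ : ∀ {z w} → (∀ n → seq (re z) n ≡ seq (re w) n) → (∀ n → seq (im z) n ≡ seq (im w) n) → z ≈ w
pointwiseℂ re≡ im≡ = mk≈ (pointwise re≡) (pointwise im≡)

ℂ-commutativeRing : CommutativeRing 0ℓ 0ℓ
ℂ-commutativeRing = record
  { RawRing ℂ-rawRing
  ; isCommutativeRing = record
    { isRing = record
      { +-isAbelianGroup = record
        { isGroup = record
          { isMonoid = record
            { isSemigroup = record
              { isMagma = record
                { isEquivalence = record
                  { refl  = pointwiseℂ (λ _ → refl) (λ _ → refl)
                  ; sym   = λ e → mk≈ (≈ℝ-sym (re≈ e)) (≈ℝ-sym (im≈ e))
                  ; trans = λ e e′ → mk≈ (≈ℝ-trans (re≈ e) (re≈ e′)) (≈ℝ-trans (im≈ e) (im≈ e′))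
                  }
                ; ∙-cong = λ e e′ → mk≈ (+ℝ-cong (re≈ e) (re≈ e′)) (+ℝ-cong (im≈ e) (im≈ e′))
                }
              ; assoc = λ z w u → pointwiseℂ
                (λ n → +-assoc (seq (re z) n) (seq (re w) n) (seq (re u) n))
                (λ n → +-assoc (seq (im z) n) (seq (im w) n) (seq (im u) n))
              }
            ; identity = (λ z → pointwiseℂ (λ n → +-identityˡ (seq (re z) n)) (λ n → +-identityˡ (seq (im z) n)))
                       , (λ z → pointwiseℂ (λ n → +-identityʳ (seq (re z) n)) (λ n → +-identityʳ (seq (im z) n)))
            }
          ; inverse = (λ z → pointwiseℂ (λ n → +-inverseˡ (seq (re z) n)) (λ n → +-inverseˡ (seq (im z) n)))
                    , (λ z → pointwiseℂ (λ n → +-inverseʳ (seq (re z) n)) (λ n → +-inverseʳ (seq (im z) n)))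
          ; ⁻¹-cong = λ e → mk≈ (-ℝ-cong (re≈ e)) (-ℝ-cong (im≈ e))
          }
        ; comm = λ z w → pointwiseℂ
          (λ n → +-comm (seq (re z) n) (seq (re w) n)) (λ n → +-comm (seq (im z) n) (seq (im w) n))
        }
      ; *-cong = λ e e′ → mk≈
        (+ℝ-cong (*ℝ-cong (re≈ e) (re≈ e′)) (-ℝ-cong (*ℝ-cong (im≈ e) (im≈ e′))))
        (+ℝ-cong (*ℝ-cong (re≈ e) (im≈ e′)) (*ℝ-cong (im≈ e) (re≈ e′)))
      ; *-assoc = λ z w u → pointwiseℂ
        (λ n → solve 6 (λ a b c d e f →
            (a :* c :+ :- (b :* d)) :* e :+ :- ((a :* d :+ b :* c) :* f)
          := a :* (c :* e :+ :- (d :* f)) :+ :- (b :* (c :* f :+ d :* e))) refl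
          (seq (re z) n) (seq (im z) n) (seq (re w) n) (seq (im w) n) (seq (re u) n) (seq (im u) n))
        (λ n → solve 6 (λ a b c d e f →
            (a :* c :+ :- (b :* d)) :* f :+ (a :* d :+ b :* c) :* e
          := a :* (c :* f :+ d :* e) :+ b :* (c :* e :+ :- (d :* f))) refl
          (seq (re z) n) (seq (im z) n) (seq (re w) n) (seq (im w) n) (seq (re u) n) (seq (im u) n))
      ; *-identity =
          (λ z → pointwiseℂ
            (λ n → solve 2 (λ a b → con 1ℚ :* a :+ :- (con 0ℚ :* b) := a) refl (seq (re z) n) (seq (im z) n))
            (λ n → solve 2 (λ a b → con 1ℚ :* b :+ con 0ℚ :* a := b) refl (seq (re z) n) (seq (im z) n)))
        , (λ z → pointwiseℂ
            (λ n → solve 2 (λ a b → a :* con 1ℚ :+ :- (b :* con 0ℚ) := a) refl (seq (re z) n) (seq (im z) n))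
            (λ n → solve 2 (λ a b → a :* con 0ℚ :+ b :* con 1ℚ := b) refl (seq (re z) n) (seq (im z) n)))
      ; distrib =
          (λ z w u → pointwiseℂ
            (λ n → solve 6 (λ a b c d e f →
                a :* (c :+ e) :+ :- (b :* (d :+ f)) := (a :* c :+ :- (b :* d)) :+ (a :* e :+ :- (b :* f))) refl
              (seq (re z) n) (seq (im z) n) (seq (re w) n) (seq (im w) n) (seq (re u) n) (seq (im u) n))
            (λ n → solve 6 (λ a b c d e f →
                a :* (d :+ f) :+ b :* (c :+ e) := (a :* d :+ b :* c) :+ (a :* f :+ b :* e)) refl
              (seq (re z) n) (seq (im z) n) (seq (re w) n) (seq (im w) n) (seq (re u) n) (seq (im u) n)))
        , (λ z w u → pointwiseℂ
            (λ n → solve 6 (λ a b c d e f →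
                (c :+ e) :* a :+ :- ((d :+ f) :* b) := (c :* a :+ :- (d :* b)) :+ (e :* a :+ :- (f :* b))) refl
              (seq (re z) n) (seq (im z) n) (seq (re w) n) (seq (im w) n) (seq (re u) n) (seq (im u) n))
            (λ n → solve 6 (λ a b c d e f →
                (c :+ e) :* b :+ (d :+ f) :* a := (c :* b :+ d :* a) :+ (e :* b :+ f :* a)) refl
              (seq (re z) n) (seq (im z) n) (seq (re w) n) (seq (im w) n) (seq (re u) n) (seq (im u) n)))
      }
    ; *-comm = λ z w → pointwiseℂ
        (λ n → solve 4 (λ a b c d → a :* c :+ :- (b :* d) := c :* a :+ :- (d :* b)) refl
          (seq (re z) n) (seq (im z) n) (seq (re w) n) (seq (im w) n))
        (λ n → solve 4 (λ a b c d → a :* d :+ b :* c := c :* b :+ d :* a) refl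
          (seq (re z) n) (seq (im z) n) (seq (re w) n) (seq (im w) n))
    }
  }

-- Apartness from zero, stability and cancellation.

-- The positive form of x ≠ 0: unlike a negated equality, it supplies an explicit lower bound that
-- estimates can use.
BoundedAway : ℝ → Set
BoundedAway x = ∃ λ δ → 0ℚ < δ × ∃ λ N → ∀ n → N ℕ.≤ n → δ ≤ ∣ seq x n ∣

0ℝ : ℝ
0ℝ = fromℚ 0ℚ

∣x-0∣≡∣x∣ : ∀ q → ∣ q - 0ℚ ∣ ≡ ∣ q ∣
∣x-0∣≡∣x∣ q = cong ∣_∣ (+-identityʳ q)

-- If |x_N| ≥ ε/2 at an index N beyond which x varies by less than ε/4, then
-- x stays away from 0 by ε/4; otherwise it stays below ε/2 + ε/4.
small-or-away : ∀ x ε → 0ℚ < ε → (∃ λ N → ∀ n → N ℕ.≤ n → ∣ seq x n ∣ < ε) ⊎ BoundedAway x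
small-or-away x ε 0<ε with cauchy x (ε * ½ * ½) (half (half 0<ε))
... | N , h with ∣ seq x N ∣ <? ε * ½
...   | yes small = inj₁ (N , λ n N≤n → begin-strict
  ∣ seq x n ∣                                       ≡⟨ cong ∣_∣ (split (seq x n) (seq x N)) ⟩
  ∣ (seq x n - seq x N) + seq x N ∣                 ≤⟨ ∣p+q∣≤∣p∣+∣q∣ (seq x n - seq x N) (seq x N) ⟩
  ∣ seq x n - seq x N ∣ + ∣ seq x N ∣               <⟨ +-mono-< (h n N N≤n ℕ.≤-refl) small ⟩
  ε * ½ * ½ + ε * ½                                 <⟨ +-monoˡ-< (ε * ½) (quarter<half) ⟩
  ε * ½ + ε * ½                                     ≡⟨ half+half ε ⟩
  ε                                                 ∎)
  where
  open ≤-Reasoning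
  split : ∀ a b → a ≡ (a - b) + b
  split = solve 2 (λ a b → a := (a :- b) :+ b) refl
  quarter<half : ε * ½ * ½ < ε * ½
  quarter<half = subst₂ _<_ (+-identityʳ _) (half+half (ε * ½)) (+-monoʳ-< (ε * ½ * ½) (half (half 0<ε)))
...   | no ¬small = inj₂ (ε * ½ * ½ , half (half 0<ε) , N , λ n N≤n → ≮⇒≥ λ xₙ<¼ε → ¬small (begin-strict
  ∣ seq x N ∣                                       ≡⟨ cong ∣_∣ (split (seq x n) (seq x N)) ⟩
  ∣ (seq x N - seq x n) + seq x n ∣                 ≤⟨ ∣p+q∣≤∣p∣+∣q∣ (seq x N - seq x n) (seq x n) ⟩
  ∣ seq x N - seq x n ∣ + ∣ seq x n ∣               <⟨ +-mono-< (h N n ℕ.≤-refl N≤n) xₙ<¼ε ⟩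
  ε * ½ * ½ + ε * ½ * ½                             ≡⟨ half+half (ε * ½) ⟩
  ε * ½                                             ∎))
  where
  open ≤-Reasoning
  split : ∀ a b → b ≡ (b - a) + a
  split = solve 2 (λ a b → b := (b :- a) :+ a) refl

-- For each ε, `small-or-away` offers two alternatives; with the second one refuted, the first holds
-- for every ε, and this is convergence to 0.
¬boundedAway⇒≈0 : ∀ {x} → ¬ BoundedAway x → x ≈ℝ 0ℝ
¬boundedAway⇒≈0 {x} ¬away .difference→0 ε 0<ε with small-or-away x ε 0<ε
... | inj₁ (N , h) = N , λ n N≤n → subst (_< ε) (sym (∣x-0∣≡∣x∣ (seq x n))) (h n N≤n)
... | inj₂ away    = contradiction away ¬away

-- Where |y| ≥ δ, a term with |x| ≥ ε would force |xy| ≥ εδ; hence the tolerance `ε * δ` for the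
-- product.
boundedAway-cancelʳ : ∀ {x y} → BoundedAway y → x *ℝ y ≈ℝ 0ℝ → x ≈ℝ 0ℝ
boundedAway-cancelʳ {x} {y} (δ , 0<δ , N , h) xy≈0 .difference→0 ε 0<ε
  with xy≈0 .difference→0 (ε * δ) (0<* 0<ε 0<δ)
... | N′ , h′ = N ⊔ N′ , λ n le → subst (_< ε) (sym (∣x-0∣≡∣x∣ (seq x n))) (≰⇒> λ ε≤x →
  <-irrefl refl (begin-strict
    ε * δ                             ≤⟨ *-monoʳ-≤-nonNeg δ {{nonNegative (<⇒≤ 0<δ)}} ε≤x ⟩
    ∣ seq x n ∣ * δ                   ≤⟨ *-monoˡ-≤-nonNeg ∣ seq x n ∣ {{nonNegative (0≤∣p∣ (seq x n))}}
                                           (h n (ℕ.m⊔n≤o⇒m≤o N N′ le)) ⟩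
    ∣ seq x n ∣ * ∣ seq y n ∣         ≡⟨ ∣p*q∣≡∣p∣*∣q∣ (seq x n) (seq y n) ⟨
    ∣ seq x n * seq y n ∣             ≡⟨ ∣x-0∣≡∣x∣ _ ⟨
    ∣ seq x n * seq y n - 0ℚ ∣        <⟨ h′ n (ℕ.m⊔n≤o⇒n≤o N N′ le) ⟩
    ε * δ                             ∎))
  where open ≤-Reasoning

-- Refuting `BoundedAway x` is a negative goal, so the double negation can be removed there;
-- `¬boundedAway⇒≈0` then returns to the equality.
≈0-stable : ∀ {x} → ¬ ¬ (x ≈ℝ 0ℝ) → x ≈ℝ 0ℝ
≈0-stable {x} ¬¬x≈0 = ¬boundedAway⇒≈0 λ (δ , 0<δ , N , h) → ¬¬x≈0 λ x≈0 →
  let N′ , h′ = x≈0 .difference→0 δ 0<δ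
      xₙ<δ = subst (_< δ) (∣x-0∣≡∣x∣ (seq x (N ⊔ N′))) (h′ (N ⊔ N′) (ℕ.m≤n⊔m N N′))
  in <-irrefl refl (<-≤-trans xₙ<δ (h (N ⊔ N′) (ℕ.m≤m⊔n N N′)))

0≤p*p : ∀ p → 0ℚ ≤ p * p
0≤p*p p = subst (0ℚ ≤_) (trans (∣p*q∣≡∣p∣*∣q∣ p p) ∣p∣*∣p∣≡p*p) (0≤∣p∣ (p * p))
  where
  ∣p∣*∣p∣≡p*p : ∣ p ∣ * ∣ p ∣ ≡ p * p
  ∣p∣*∣p∣≡p*p with ∣p∣≡p∨∣p∣≡-p p
  ... | inj₁ e = cong₂ _*_ e e
  ... | inj₂ e = trans (cong₂ _*_ e e) (solve 1 (λ a → (:- a) :* (:- a) := a :* a) refl p)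

-- A term with |x| ≥ ε would give x² + y² ≥ ε², because y² ≥ 0; hence the tolerance `ε * ε`.
x²+y²≈0⇒x≈0 : ∀ x y → x *ℝ x +ℝ y *ℝ y ≈ℝ 0ℝ → x ≈ℝ 0ℝ
x²+y²≈0⇒x≈0 x y x²+y²≈0 .difference→0 ε 0<ε with x²+y²≈0 .difference→0 (ε * ε) (0<* 0<ε 0<ε)
... | N , h = N , λ n N≤n → subst (_< ε) (sym (∣x-0∣≡∣x∣ (seq x n))) (≰⇒> λ ε≤x →
  <-irrefl refl (begin-strict
    ε * ε                                                ≤⟨ *-monoʳ-≤-nonNeg ε {{nonNegative (<⇒≤ 0<ε)}} ε≤x ⟩
    ∣ seq x n ∣ * ε                                      ≤⟨ *-monoˡ-≤-nonNeg ∣ seq x n ∣ {{nonNegative (0≤∣p∣ (seq x n))}} ε≤x ⟩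
    ∣ seq x n ∣ * ∣ seq x n ∣                            ≡⟨ ∣p*q∣≡∣p∣*∣q∣ (seq x n) (seq x n) ⟨
    ∣ seq x n * seq x n ∣                                ≡⟨ 0≤p⇒∣p∣≡p (0≤p*p (seq x n)) ⟩
    seq x n * seq x n                                    ≡⟨ +-identityʳ _ ⟨
    seq x n * seq x n + 0ℚ                               ≤⟨ +-monoʳ-≤ (seq x n * seq x n) (0≤p*p (seq y n)) ⟩
    seq x n * seq x n + seq y n * seq y n                ≡⟨ 0≤p⇒∣p∣≡p (+-mono-≤ (0≤p*p (seq x n)) (0≤p*p (seq y n))) ⟨
    ∣ seq x n * seq x n + seq y n * seq y n ∣            ≡⟨ ∣x-0∣≡∣x∣ _ ⟨
    ∣ seq x n * seq x n + seq y n * seq y n - 0ℚ ∣       <⟨ h n N≤n ⟩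
    ε * ε                                                ∎))
  where
  open ≤-Reasoning

module C = CommutativeRing ℂ-commutativeRing

≈0ℂ-stable : ∀ {z} → ¬ ¬ (z ≈ 0ℂ) → z ≈ 0ℂ
≈0ℂ-stable ¬¬z≈0 = mk≈ (≈0-stable λ ¬re → ¬¬z≈0 (¬re ∘ re≈)) (≈0-stable λ ¬im → ¬¬z≈0 (¬im ∘ im≈))

-- Multiplying by the conjugate of z reduces the claim to the real factor |z|².
z*w≈0∧z≉0⇒w≈0 : ∀ {z w} → z *ℂ w ≈ 0ℂ → ¬ z ≈ 0ℂ → w ≈ 0ℂ
z*w≈0∧z≉0⇒w≈0 {z} {w} zw≈0 z≉0 = mk≈
  (cancel (≈ℝ-trans (pointwise λ n → re-eq (seq (re z) n) (seq (im z) n) (seq (re w) n) (seq (im w) n)) (re≈ z̄zw≈0)))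
  (cancel (≈ℝ-trans (pointwise λ n → im-eq (seq (re z) n) (seq (im z) n) (seq (re w) n) (seq (im w) n)) (im≈ z̄zw≈0)))
  where
  z̄ : ℂ
  z̄ = re z +i (-ℝ im z)
  ∣z∣² : ℝ
  ∣z∣² = re z *ℝ re z +ℝ im z *ℝ im z
  z̄zw≈0 : z̄ *ℂ (z *ℂ w) ≈ 0ℂ
  z̄zw≈0 = C.trans (C.*-congˡ {z̄} zw≈0) (C.zeroʳ z̄)
  ∣z∣²≉0 : ¬ ∣z∣² ≈ℝ 0ℝ
  ∣z∣²≉0 ∣z∣²≈0 = z≉0 (mk≈ (x²+y²≈0⇒x≈0 (re z) (im z) ∣z∣²≈0)
    (x²+y²≈0⇒x≈0 (im z) (re z) (≈ℝ-trans (pointwise λ n → +-comm (seq (im z) n * seq (im z) n) _) ∣z∣²≈0)))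
  cancel : ∀ {x} → ∣z∣² *ℝ x ≈ℝ 0ℝ → x ≈ℝ 0ℝ
  -- The roles are reversed here: `z≉0` gives no lower bound for |z|², so it is `x` that is assumed
  -- bounded away from 0 and cancelled, which leaves |z|² ≈ 0, a contradiction.
  cancel ∣z∣²x≈0 = ¬boundedAway⇒≈0 λ away → ∣z∣²≉0 (boundedAway-cancelʳ away ∣z∣²x≈0)
  re-eq : ∀ a b c d → (a * a + b * b) * c ≡ a * (a * c + - (b * d)) + - (- b * (a * d + b * c))
  re-eq = solve 4 (λ a b c d → (a :* a :+ b :* b) :* c
    := a :* (a :* c :+ :- (b :* d)) :+ :- ((:- b) :* (a :* d :+ b :* c))) refl
  im-eq : ∀ a b c d → (a * a + b * b) * d ≡ a * (a * d + b * c) + - b * (a * c + - (b * d))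
  im-eq = solve 4 (λ a b c d → (a :* a :+ b :* b) :* d
    := a :* (a :* d :+ b :* c) :+ (:- b) :* (a :* c :+ :- (b :* d))) refl

-- Finite sums and digit counts.

module Σ = Sum C.+-commutativeMonoid
module SemiringSum = SemiringSumProperties C.semiring
open RingProperties C.ring using (x[y-z]≈xy-xz)
open GroupProperties C.+-group using (x∙y⁻¹≈ε⇒x≈y)
module ≈-Reasoning = SetoidReasoning C.setoid

-- `sum` unfolds at its first term, whereas the inductions on the upper limit need the last term
-- split off.
∑₁-suc : ∀ n g → ∑₁ (suc n) g ≈ ∑₁ n g +ℂ g (suc n)
∑₁-suc n g = C.trans (Σ.sum-init-last (λ i → g (suc (toℕ i))))
  (C.+-cong (Σ.sum-cong-≋ {n} (λ i → C.reflexive (cong (g ∘ suc) (toℕ-inject₁ i))))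
            (C.reflexive (cong (g ∘ suc) (toℕ-fromℕ n))))

sum-indicator : ∀ {n} (Y : Fin n → ℂ) d → sum (λ l → if does (l Fin.≟ d) then Y l else 0ℂ) ≈ Y d
sum-indicator {suc n} Y zero    = C.trans (C.+-congˡ {Y zero} (Σ.sum-replicate-zero n)) (C.+-identityʳ (Y zero))
sum-indicator         Y (suc d) = C.trans (C.+-identityˡ _) (sum-indicator (Y ∘ suc) d)

-- `digitCount` for an arbitrary list in place of the digits of a number, which allows induction on
-- the list.
occurrences : ∀ {b} → List (Fin b) → Fin b → ℕ
occurrences ds l = length (filter (l Fin.≟_) ds)

-- Prepending `d` raises by one the count of `d` and no other count, so the weighted sum grows by a
-- single `Y d`.
sum-occurrences-∷ : ∀ {b} (Y : Fin b → ℂ) d ds →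
  sum (λ l → occurrences (d ∷ ds) l · Y l) ≈ Y d +ℂ sum (λ l → occurrences ds l · Y l)
sum-occurrences-∷ {b} Y d ds = C.trans (Σ.sum-cong-≋ {b} step)
  (C.trans (Σ.∑-distrib-+ indicator (λ l → occurrences ds l · Y l)) (C.+-congʳ (sum-indicator Y d)))
  where
  indicator : Fin b → ℂ
  indicator l = if does (l Fin.≟ d) then Y l else 0ℂ
  step : ∀ l → occurrences (d ∷ ds) l · Y l ≈ indicator l +ℂ (occurrences ds l · Y l)
  -- `filter` branches on this same boolean, so fixing its value reduces both sides at once.
  step l with does (l Fin.≟ d)
  ... | true  = C.refl
  ... | false = C.sym (C.+-identityˡ _)

-- Multiplication modulo n.

-- If Bézout's identity yields t = x * m ≡ -1 (mod n), then t² ≡ 1.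
modular-inverse : ∀ {m n} .{{_ : NonZero n}} → Coprime m n → ∃ λ x → (x ℕ.* m) % n ≡ 1 % n
modular-inverse {m} {n} m⊥n with coprime-Bézout m⊥n
... | Bézout.+- x y eq = x , trans (cong (_% n) (sym eq)) ([m+kn]%n≡m%n 1 y n)
... | Bézout.-+ x y eq = x ℕ.* m ℕ.* x , (begin
  (x ℕ.* m ℕ.* x ℕ.* m) % n                        ≡⟨ [m+kn]%n≡m%n _ y n ⟨
  (x ℕ.* m ℕ.* x ℕ.* m ℕ.+ y ℕ.* n) % n            ≡⟨ cong (λ k → (x ℕ.* m ℕ.* x ℕ.* m ℕ.+ k) % n) eq ⟨
  (x ℕ.* m ℕ.* x ℕ.* m ℕ.+ (1 ℕ.+ x ℕ.* m)) % n    ≡⟨ cong (_% n) (lemma x m) ⟩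
  (1 ℕ.+ (x ℕ.* m) ℕ.* (1 ℕ.+ x ℕ.* m)) % n        ≡⟨ cong (λ k → (1 ℕ.+ (x ℕ.* m) ℕ.* k) % n) eq ⟩
  (1 ℕ.+ (x ℕ.* m) ℕ.* (y ℕ.* n)) % n              ≡⟨ cong (λ k → (1 ℕ.+ k) % n) (ℕ.*-assoc (x ℕ.* m) y n) ⟨
  (1 ℕ.+ (x ℕ.* m ℕ.* y) ℕ.* n) % n                ≡⟨ [m+kn]%n≡m%n 1 (x ℕ.* m ℕ.* y) n ⟩
  1 % n                                            ∎)
  where
  open ≡-Reasoning
  lemma : ∀ x m → x ℕ.* m ℕ.* x ℕ.* m ℕ.+ (1 ℕ.+ x ℕ.* m) ≡ 1 ℕ.+ (x ℕ.* m) ℕ.* (1 ℕ.+ x ℕ.* m)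
  lemma = solve-∀

multiply-mod : ∀ n .{{_ : NonZero n}} → ℕ → Fin n → Fin n
multiply-mod n a i = fromℕ< (m%n<n (a ℕ.* toℕ i) n)

multiply-mod-inverse : ∀ n .{{_ : NonZero n}} a b → (a ℕ.* b) % n ≡ 1 % n →
  ∀ i → multiply-mod n a (multiply-mod n b i) ≡ i
multiply-mod-inverse n a b ab≡1 i = toℕ-injective (begin
  toℕ (multiply-mod n a (multiply-mod n b i))      ≡⟨ toℕ-fromℕ< _ ⟩
  (a ℕ.* toℕ (multiply-mod n b i)) % n             ≡⟨ cong (λ k → (a ℕ.* k) % n) (toℕ-fromℕ< (m%n<n (b ℕ.* toℕ i) n)) ⟩
  (a ℕ.* ((b ℕ.* toℕ i) % n)) % n                  ≡⟨ %-distribˡ-* a _ n ⟩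
  ((a % n) ℕ.* ((b ℕ.* toℕ i) % n % n)) % n        ≡⟨ cong (λ k → ((a % n) ℕ.* k) % n) (m%n%n≡m%n (b ℕ.* toℕ i) n) ⟩
  ((a % n) ℕ.* ((b ℕ.* toℕ i) % n)) % n            ≡⟨ %-distribˡ-* a (b ℕ.* toℕ i) n ⟨
  (a ℕ.* (b ℕ.* toℕ i)) % n                        ≡⟨ cong (_% n) (ℕ.*-assoc a b (toℕ i)) ⟨
  (a ℕ.* b ℕ.* toℕ i) % n                          ≡⟨ %-distribˡ-* (a ℕ.* b) (toℕ i) n ⟩
  (((a ℕ.* b) % n) ℕ.* (toℕ i % n)) % n            ≡⟨ cong (λ k → (k ℕ.* (toℕ i % n)) % n) ab≡1 ⟩
  ((1 % n) ℕ.* (toℕ i % n)) % n                    ≡⟨ %-distribˡ-* 1 (toℕ i) n ⟨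
  (1 ℕ.* toℕ i) % n                                ≡⟨ cong (_% n) (ℕ.*-identityˡ (toℕ i)) ⟩
  toℕ i % n                                        ≡⟨ m<n⇒m%n≡m (toℕ<n i) ⟩
  toℕ i                                            ∎)
  where open ≡-Reasoning

-- Since a = r + (a / k) k, a common divisor of the remainder r and of k also divides a.
coprime-%ℕ : ∀ k .{{_ : NonZero k}} a → ℤ.Coprime a (+ k) → Coprime (a %ℕ k) k
coprime-%ℕ k a a⊥k {d} (d∣r , d∣k) = a⊥k (ℤ.∣⇒∣ᵤ d∣a , d∣k)
  where
  d∣a : + d ℤ.∣ a
  d∣a = subst (+ d ℤ.∣_) (sym (a≡a%ℕn+[a/ℕn]*n a k))
    (ℤ.∣m∣n⇒∣m+n {m = + (a %ℕ k)} (ℤ.∣ᵤ⇒∣ d∣r) (ℤ.∣n⇒∣m*n (a /ℕ k) {+ k} (ℤ.∣ᵤ⇒∣ d∣k)))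

-- Dirichlet characters: periodicity and the sum over a full period.

module _ {k : ℕ} .{{_ : NonZero k}} {χ : ℤ → ℂ} (isχ : IsDirichletCharacter k χ) where
  private module χ = IsDirichletCharacter isχ

  χ-+* : ∀ a q → χ (a +ℤ + (q ℕ.* k)) ≈ χ a
  χ-+* a zero    = C.reflexive (cong χ (ℤ.+-identityʳ a))
  χ-+* a (suc q) = C.trans
    (C.reflexive (cong χ (trans
      (cong (a +ℤ_) (cong +_ (ℕ.+-comm k (q ℕ.* k))))
      (sym (ℤ.+-assoc a (+ (q ℕ.* k)) (+ k))))))
    (C.trans (χ.periodic (a +ℤ + (q ℕ.* k))) (χ-+* a q))

  χ-+ℤ* : ∀ a q → χ (a +ℤ q *ℤ + k) ≈ χ a
  χ-+ℤ* a (+ q)    = C.trans (C.reflexive (cong (λ c → χ (a +ℤ c)) (sym (ℤ.pos-* q k)))) (χ-+* a q)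
  -- For a negative multiple, adding q + 1 periods to the shifted argument `b` leads back to `a`.
  χ-+ℤ* a -[1+ q ] = C.trans (C.sym (χ-+* b (suc q))) (C.reflexive (cong χ (begin
    a +ℤ -[1+ q ] *ℤ + k +ℤ + (suc q ℕ.* k)           ≡⟨ ℤ.+-assoc a _ _ ⟩
    a +ℤ (-[1+ q ] *ℤ + k +ℤ + (suc q ℕ.* k))         ≡⟨ cong (λ c → a +ℤ (-[1+ q ] *ℤ + k +ℤ c)) (ℤ.pos-* (suc q) k) ⟩
    a +ℤ (-[1+ q ] *ℤ + k +ℤ + suc q *ℤ + k)          ≡⟨ cong (a +ℤ_) (ℤ.*-distribʳ-+ (+ k) -[1+ q ] (+ suc q)) ⟨
    a +ℤ (-[1+ q ] +ℤ + suc q) *ℤ + k                 ≡⟨ cong (λ c → a +ℤ c *ℤ + k) (ℤ.+-inverseˡ (+ suc q)) ⟩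
    a +ℤ + 0                                          ≡⟨ ℤ.+-identityʳ a ⟩
    a                                                 ∎)))
    where
    open ≡-Reasoning
    b = a +ℤ -[1+ q ] *ℤ + k

  χ-%ℕ : ∀ a → χ a ≈ χ (+ (a %ℕ k))
  χ-%ℕ a = C.trans (C.reflexive (cong χ (a≡a%ℕn+[a/ℕn]*n a k))) (χ-+ℤ* (+ (a %ℕ k)) (a /ℕ k))

  -- The index starts at 0 so that it runs over all residues, the set which multiplication by a unit
  -- permutes.
  ∑χ : ℂ
  ∑χ = sum {k} (λ i → χ (+ toℕ i))

  -- Multiplying by a, which is invertible modulo k, permutes all the residues and not only the
  -- units, so the sum need not be restricted to indices coprime to k.
  χ[a]*∑χ≈∑χ : ∀ a → Coprime a k → χ (+ a) *ℂ ∑χ ≈ ∑χ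
  χ[a]*∑χ≈∑χ a a⊥k = begin
    χ (+ a) *ℂ ∑χ                                      ≈⟨ SemiringSum.*-distribˡ-sum {k} (χ (+ a)) (λ i → χ (+ toℕ i)) ⟩
    sum {k} (λ i → χ (+ a) *ℂ χ (+ toℕ i))             ≈⟨ Σ.sum-cong-≋ {k} reindex ⟩
    sum {k} (λ i → χ (+ toℕ (multiply-mod k a i)))     ≈⟨ Σ.sum-permute (λ i → χ (+ toℕ i)) π ⟨
    ∑χ                                                 ∎
    where
    open ≈-Reasoning
    a⁻¹ = proj₁ (modular-inverse a⊥k)
    a⁻¹*a≡1 = proj₂ (modular-inverse a⊥k)
    π : Permutation k k
    π = permutation (multiply-mod k a) (multiply-mod k a⁻¹)
      (multiply-mod-inverse k a a⁻¹ (trans (cong (_% k) (ℕ.*-comm a a⁻¹)) a⁻¹*a≡1))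
      (multiply-mod-inverse k a⁻¹ a a⁻¹*a≡1)
    reindex : ∀ i → χ (+ a) *ℂ χ (+ toℕ i) ≈ χ (+ toℕ (multiply-mod k a i))
    reindex i = begin
      χ (+ a) *ℂ χ (+ toℕ i)                 ≈⟨ χ.multiplicative (+ a) (+ toℕ i) ⟨
      χ (+ a *ℤ + toℕ i)                     ≡⟨ cong χ (ℤ.pos-* a (toℕ i)) ⟨
      χ (+ (a ℕ.* toℕ i))                    ≈⟨ χ-%ℕ (+ (a ℕ.* toℕ i)) ⟩
      χ (+ ((a ℕ.* toℕ i) % k))              ≡⟨ cong (χ ∘ +_) (toℕ-fromℕ< (m%n<n (a ℕ.* toℕ i) k)) ⟨
      χ (+ toℕ (multiply-mod k a i))         ∎

  ¬principal⇒∑χ≈0 : ¬ IsPrincipal k χ → ∑χ ≈ 0ℂ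
  ¬principal⇒∑χ≈0 ¬principal = ≈0ℂ-stable λ ∑χ≉0 → ¬principal λ a a⊥k →
    -- The integer `a` is replaced by its residue, because the invariance of the period sum is
    -- stated for natural multipliers; coprimality to k passes to the residue.
    C.trans (χ-%ℕ a) (x-y≈0⇒x≈y (z*w≈0∧z≉0⇒w≈0 (∑χ*[χ-1]≈0 (a %ℕ k) (coprime-%ℕ k a a⊥k)) ∑χ≉0))
    where
    open ≈-Reasoning
    x-y≈0⇒x≈y : ∀ {x y} → x C.- y ≈ 0ℂ → x ≈ y
    x-y≈0⇒x≈y {x} {y} = x∙y⁻¹≈ε⇒x≈y x y
    ∑χ*[χ-1]≈0 : ∀ r → Coprime r k → ∑χ *ℂ (χ (+ r) C.- 1ℂ) ≈ 0ℂ
    ∑χ*[χ-1]≈0 r r⊥k = begin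
      ∑χ *ℂ (χ (+ r) C.- 1ℂ)              ≈⟨ x[y-z]≈xy-xz ∑χ (χ (+ r)) 1ℂ ⟩
      ∑χ *ℂ χ (+ r) C.- ∑χ *ℂ 1ℂ          ≈⟨ C.+-cong (C.trans (C.*-comm ∑χ (χ (+ r))) (χ[a]*∑χ≈∑χ r r⊥k))
                                                    (C.-‿cong (C.*-identityʳ ∑χ)) ⟩
      ∑χ C.- ∑χ                           ≈⟨ C.-‿inverseʳ ∑χ ⟩
      0ℂ                                  ∎

  ¬coprime⇒χ≈0 : ∀ a → ¬ ℤ.Coprime a (+ k) → χ a ≈ 0ℂ
  ¬coprime⇒χ≈0 a = Equivalence.from (χ.vanishing a)

-- The partial sums of f along base p digits.

module _ {p′ : ℕ} (p-prime : Prime (suc p′))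
         {χ : ℤ → ℂ} (isχ : IsDirichletCharacter (suc p′) χ) (¬principal : ¬ IsPrincipal (suc p′) χ)
         {f : ℕ → ℂ} (isf : IsCompletelyMultiplicative f)
         (f[p]≈1 : f (suc p′) ≈ 1ℂ) (f[q]≈χ[q] : ∀ q → Prime q → q ≢ suc p′ → f q ≈ χ (+ q)) where
  private
    p = suc p′
    module χ = IsDirichletCharacter isχ
    module f = IsCompletelyMultiplicative isf

  ∑₁χ : ℕ → ℂ
  ∑₁χ l = ∑₁ l (λ m → χ (+ m))

  -- This differs from the full period sum only by the term χ(0), which vanishes because 0 and p
  -- have the common divisor p > 1.
  ∑₁χ[p-1]≈0 : ∑₁χ p′ ≈ 0ℂ
  ∑₁χ[p-1]≈0 = begin
    ∑₁χ p′                     ≈⟨ C.+-identityˡ (∑₁χ p′) ⟨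
    0ℂ +ℂ ∑₁χ p′               ≈⟨ C.+-congʳ (¬coprime⇒χ≈0 isχ (+ 0) ¬0⊥p) ⟨
    χ (+ 0) +ℂ ∑₁χ p′          ≈⟨ ¬principal⇒∑χ≈0 isχ ¬principal ⟩
    0ℂ                         ∎
    where
    open ≈-Reasoning
    ¬0⊥p : ¬ Coprime 0 p
    ¬0⊥p 0⊥p = ¬prime[1] (subst Prime (0-coprimeTo-m⇒m≡1 0⊥p) p-prime)

  -- Both functions are multiplicative and agree at each factor: a prime `q` in the list cannot be
  -- p, as p would then divide the product.
  f-product : ∀ {qs} → All Prime qs → ¬ p ∣ product qs → f (product qs) ≈ χ (+ product qs)
  f-product []                       p∤ = C.trans f.one (C.sym χ.one)
  f-product {q ∷ qs} (q-prime ∷ qs-prime) p∤ = begin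
    f (q ℕ.* product qs)                ≈⟨ f.multiplicative q (product qs)
                                             {{prime⇒nonZero q-prime}} {{productOfPrimes≢0 qs-prime}} ⟩
    f q *ℂ f (product qs)               ≈⟨ C.*-cong (f[q]≈χ[q] q q-prime (λ { refl → p∤ (m∣m*n (product qs)) }))
                                                  (f-product qs-prime (p∤ ∘ ∣n⇒∣m*n q)) ⟩
    χ (+ q) *ℂ χ (+ product qs)         ≈⟨ χ.multiplicative (+ q) (+ product qs) ⟨
    χ (+ q *ℤ + product qs)            ≡⟨ cong χ (ℤ.pos-* q (product qs)) ⟨
    χ (+ (q ℕ.* product qs))            ∎
    where open ≈-Reasoning

  p∤n⇒f[n]≈χ[n] : ∀ n .{{_ : NonZero n}} → ¬ p ∣ n → f n ≈ χ (+ n)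
  p∤n⇒f[n]≈χ[n] n p∤n = subst (λ n → f n ≈ χ (+ n)) (sym (isFactorisation n-factors))
    (f-product (factorsPrime n-factors) (p∤n ∘ subst (p ∣_) (sym (isFactorisation n-factors))))
    where
    n-factors = factorise n

  -- If p divided r + qp it would divide r, impossible for 0 < r < p; so f agrees with χ there, and
  -- periodicity removes qp.
  f[r+qp]≈χ[r] : ∀ r q .{{_ : NonZero r}} → r ℕ.< p → f (r ℕ.+ q ℕ.* p) ≈ χ (+ r)
  f[r+qp]≈χ[r] r@(suc _) q r<p = C.trans
    (p∤n⇒f[n]≈χ[n] (r ℕ.+ q ℕ.* p) λ p∣ → >⇒∤ r<p
      (∣m+n∣m⇒∣n (subst (p ∣_) (ℕ.+-comm r (q ℕ.* p)) p∣) (n∣m*n q)))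
    (χ-+* isχ (+ r) q)

  -- The argument is (1 + q)p by definition of multiplication, and f(p) = 1.
  f[p+qp]≈f[1+q] : ∀ q → f (p ℕ.+ q ℕ.* p) ≈ f (suc q)
  f[p+qp]≈f[1+q] q = C.trans (f.multiplicative (suc q) p)
    (C.trans (C.*-congˡ {f (suc q)} f[p]≈1) (C.*-identityʳ (f (suc q))))

  -- The upper limit is lowered by one at each step. Within a block r decreases; from r = 0 the
  -- recursion passes to r = p - 1 in the preceding block, so the pair (q, r) decreases
  -- lexicographically.
  ∑f-last-digit : ∀ r q → r ℕ.< p → ∑₁ (r ℕ.+ q ℕ.* p) f ≈ ∑₁ q f +ℂ ∑₁χ r
  ∑f-last-digit zero    zero    _   = C.sym (C.+-identityʳ 0ℂ)
  ∑f-last-digit zero    (suc q) _   = begin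
    ∑₁ (p ℕ.+ q ℕ.* p) f                                 ≈⟨ ∑₁-suc (p′ ℕ.+ q ℕ.* p) f ⟩
    -- The last index is (q + 1)p, whose term becomes f(q + 1); the rest ends at digit p - 1, where
    -- the character sum is 0.
    ∑₁ (p′ ℕ.+ q ℕ.* p) f +ℂ f (p ℕ.+ q ℕ.* p)           ≈⟨ C.+-cong (∑f-last-digit p′ q (ℕ.n<1+n p′)) (f[p+qp]≈f[1+q] q) ⟩
    (∑₁ q f +ℂ ∑₁χ p′) +ℂ f (suc q)                      ≈⟨ C.+-congʳ (C.+-congˡ {∑₁ q f} ∑₁χ[p-1]≈0) ⟩
    (∑₁ q f +ℂ 0ℂ) +ℂ f (suc q)                          ≈⟨ C.+-congʳ (C.+-identityʳ (∑₁ q f)) ⟩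
    ∑₁ q f +ℂ f (suc q)                                  ≈⟨ ∑₁-suc q f ⟨
    ∑₁ (suc q) f                                         ≈⟨ C.+-identityʳ (∑₁ (suc q) f) ⟨
    ∑₁ (suc q) f +ℂ 0ℂ                                   ∎
    where open ≈-Reasoning
  ∑f-last-digit (suc r) q       r<p = begin
    ∑₁ (suc r ℕ.+ q ℕ.* p) f                             ≈⟨ ∑₁-suc (r ℕ.+ q ℕ.* p) f ⟩
    ∑₁ (r ℕ.+ q ℕ.* p) f +ℂ f (suc r ℕ.+ q ℕ.* p)        ≈⟨ C.+-cong (∑f-last-digit r q (ℕ.<⇒≤ r<p)) (f[r+qp]≈χ[r] (suc r) q r<p) ⟩
    (∑₁ q f +ℂ ∑₁χ r) +ℂ χ (+ suc r)                     ≈⟨ C.+-assoc (∑₁ q f) (∑₁χ r) (χ (+ suc r)) ⟩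
    ∑₁ q f +ℂ (∑₁χ r +ℂ χ (+ suc r))                     ≈⟨ C.+-congˡ {∑₁ q f} (∑₁-suc r (λ m → χ (+ m))) ⟨
    ∑₁ q f +ℂ ∑₁χ (suc r)                                ∎
    where open ≈-Reasoning

  -- Digits are listed from the least significant, so the head is the remainder r and the tail
  -- represents the quotient q. Leading zeros do no harm: they are weighted by an empty character
  -- sum.
  ∑f-fromDigits : (ds : List (Digit p)) →
    ∑₁ (fromDigits ds) f ≈ sum {p} (λ l → occurrences ds l · ∑₁χ (toℕ l))
  ∑f-fromDigits []       = C.sym (Σ.sum-replicate-zero p)
  ∑f-fromDigits (d ∷ ds) = begin
    ∑₁ (toℕ d ℕ.+ fromDigits ds ℕ.* p) f                              ≈⟨ ∑f-last-digit (toℕ d) (fromDigits ds) (toℕ<n d) ⟩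
    ∑₁ (fromDigits ds) f +ℂ ∑₁χ (toℕ d)                               ≈⟨ C.+-congʳ (∑f-fromDigits ds) ⟩
    sum (λ l → occurrences ds l · ∑₁χ (toℕ l)) +ℂ ∑₁χ (toℕ d)         ≈⟨ C.+-comm _ _ ⟩
    ∑₁χ (toℕ d) +ℂ sum (λ l → occurrences ds l · ∑₁χ (toℕ l))         ≈⟨ sum-occurrences-∷ (∑₁χ ∘ toℕ) d ds ⟨
    sum (λ l → occurrences (d ∷ ds) l · ∑₁χ (toℕ l))                  ∎
    where open ≈-Reasoning

theorem9 : (p : ℕ) (p-prime : Prime p)
    (χ : ℤ → ℂ) → IsDirichletCharacter p χ → ¬ IsPrincipal p χ →
    (f : ℕ → ℂ) → IsCompletelyMultiplicative f →
    f p ≈ 1ℂ → (∀ q → Prime q → q ≢ p → f q ≈ χ (+ q)) →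
    (n : ℕ) → .{{NonZero n}} →
    ∑₁ n f ≈
    sum {p} (λ (l : Fin p) →
    digitCount p {{prime⇒nonTrivial p-prime}} n l · ∑₁ (toℕ l) (λ m → χ (+ m)))
theorem9 zero p-prime = contradiction p-prime ¬prime[0]
theorem9 (suc p′) p-prime χ isχ ¬principal f isf f[p]≈1 f[q]≈χ[q] n =
  -- `toDigits` comes with a proof that its list represents `n`, which turns the upper limit into
  -- `fromDigits` of that list.
  C.trans (C.reflexive (cong (λ m → ∑₁ m f) (sym (proj₂ digits))))
          (∑f-fromDigits p-prime isχ ¬principal isf f[p]≈1 f[q]≈χ[q] (proj₁ digits))
  where
  digits = toDigits (suc p′) {fromWitness (nonTrivial⇒n>1 (suc p′) {{prime⇒nonTrivial p-prime}})} n
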